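{- Let $G$ be a graph of order $n$ and size $m$ (number of edges), and let $\gamma_{\rm esp}=\gamma_{\rm esp}(G)$ be its end super domination number. Then $$m\le \binom{n}{2}-(n-\gamma_{\rm esp})(n-\gamma_{\rm esp}-1).$$ Moreover, equality holds if and only if $G$ is obtained from a complete graph $K_n$ by removing all edges of a complete bipartite subgraph $K_{n-\gamma_{\rm esp},\,n-\gamma_{\rm esp}}$ of $K_n$, except for the edges of a perfect matching between the partite sets of this bipartite subgraph.
   Context: Graphs are finite, simple and undirected. For a graph $G=(V,E)$ and $S\subseteq V$, write $\overline{S}=V\setminus S$, and let $N(v)$ be the open neighbourhood of $v$. A set $S \subseteq V$ is an end super dominating set (ESD-set) of $G$ if for every $u\in\overline{S}$ there exists $v\in S$ with $N(v)\cap\overline{S}=\{u\}$, and moreover $\deg(u)\ge 2$ for every $u\in\overline{S}$. The end super domination number $\gamma_{\rm esp}(G)$ is the minimum cardinality of an ESD-set of $G$. Here $K_{a,a}$ denotes the complete bipartite graph with both partite sets of cardinality $a$ (for $a=0$ it is empty and no edges are removed). -}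

module Defs where

open import Data.Bool.Properties using () renaming (_≟_ to _≟ᵇ_)
open import Data.Empty using (⊥-elim)
open import Data.Fin.Base using (Fin)
open import Data.Fin.Properties using (_≟_; _<?_; all?; any?)
open import Data.Fin.Subset
  using (Subset; _∈_; _∩_; _∪_; ∁; ⁅_⁆; ∣_∣; ⊤; Empty)
open import Data.Fin.Subset.Properties
  using (_∈?_; anySubset?; x∈p∩q⁺; x∈∁p⇒x∉p; ∈⊤)
open import Data.List.Base using (List; length; filter; allFin; cartesianProduct)
open import Data.Nat.Base as ℕ using (ℕ; _≤_)
open import Data.Nat.Induction using (<-wellFounded)
open import Data.Nat.Properties as ℕ using (≮⇒≥)
open import Data.Product.Base using (Σ; ∃-syntax; _×_; _,_; proj₁; proj₂)
open import Data.Sum.Base using (_⊎_; inj₁; inj₂)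
open import Data.Vec.Base using (tabulate)
open import Data.Vec.Properties using (≡-dec)
open import Function.Bundles using (_⇔_)
open import Induction.WellFounded using (Acc; acc)
open import Level using (0ℓ)
open import Relation.Binary.Core using (Rel)
open import Relation.Binary.Definitions using (Decidable; Symmetric; Irreflexive)
open import Relation.Binary.PropositionalEquality using (_≡_; refl; sym)
open import Relation.Nullary using (¬_; Dec; does; yes; no)
open import Relation.Nullary.Decidable using (_×-dec_; _⊎-dec_; _→-dec_; ¬?)

record Graph (n : ℕ) : Set₁ where
  field
    Adj    : Rel (Fin n) 0ℓ
    Adj?   : Decidable Adj
    symm   : Symmetric Adj
    irrefl : Irreflexive _≡_ Adj

open Graph public

private variable
  n : ℕ

-- Each edge {i , j} is listed once, as the pair (i , j) with i < j.
edges : Graph n → List (Fin n × Fin n)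
edges {n} G =
  filter (λ (i , j) → (i <? j) ×-dec Adj? G i j)
         (cartesianProduct (allFin n) (allFin n))

size : Graph n → ℕ
size G = length (edges G)

N : Graph n → Fin n → Subset n
N G v = tabulate λ u → does (Adj? G v u)

deg : Graph n → Fin n → ℕ
deg G v = ∣ N G v ∣

IsESD : Graph n → Subset n → Set
IsESD G S =
  (∀ u → u ∈ ∁ S → ∃[ v ] (v ∈ S × N G v ∩ ∁ S ≡ ⁅ u ⁆)) ×
  (∀ u → u ∈ ∁ S → 2 ≤ deg G u)

IsMinimumESD : Graph n → Subset n → Set
IsMinimumESD G S = IsESD G S × (∀ T → IsESD G T → ∣ S ∣ ≤ ∣ T ∣)

isESD? : (G : Graph n) (S : Subset n) → Dec (IsESD G S)
isESD? G S =
  all? (λ u → (u ∈? ∁ S) →-dec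
    any? (λ v → (v ∈? S) ×-dec ≡-dec _≟ᵇ_ (N G v ∩ ∁ S) ⁅ u ⁆)) ×-dec
  all? (λ u → (u ∈? ∁ S) →-dec (2 ℕ.≤? deg G u))

⊤-isESD : (G : Graph n) → IsESD G ⊤
⊤-isESD G =
  (λ u u∈∁⊤ → ⊥-elim (x∈∁p⇒x∉p u∈∁⊤ ∈⊤)) ,
  (λ u u∈∁⊤ → ⊥-elim (x∈∁p⇒x∉p u∈∁⊤ ∈⊤))

minimumESD : (G : Graph n) → ∃[ S ] IsMinimumESD G S
minimumESD G = go ⊤ (⊤-isESD G) (<-wellFounded _)
  where
  go : ∀ S → IsESD G S → Acc ℕ._<_ ∣ S ∣ → ∃[ S ] IsMinimumESD G S
  go S esd (acc rec)
    with anySubset? (λ T → isESD? G T ×-dec (∣ T ∣ ℕ.<? ∣ S ∣))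
  ... | yes (T , esdT , T<S) = go T esdT (rec T<S)
  ... | no ∄smaller = S , esd , λ T esdT → ≮⇒≥ λ T<S → ∄smaller (T , esdT , T<S)

γesp : Graph n → ℕ
γesp G = ∣ proj₁ (minimumESD G) ∣

-- Equality of labelled graphs: the same edges on the same vertex set.
infix 4 _≐_
_≐_ : Graph n → Graph n → Set
G ≐ H = ∀ x y → Adj G x y ⇔ Adj H x y

infix 4 _⊑_
_⊑_ : Graph n → Graph n → Set
G ⊑ H = ∀ x y → Adj G x y → Adj H x y

-- Removal of edges only: all vertices are kept.
infixl 6 _∖_
_∖_ : Graph n → Graph n → Graph n
(G ∖ H) .Adj x y = Adj G x y × ¬ Adj H x y
(G ∖ H) .Adj? x y = Adj? G x y ×-dec ¬? (Adj? H x y)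
(G ∖ H) .symm (g , ¬h) = symm G g , λ h → ¬h (symm H h)
(G ∖ H) .irrefl x≡y (g , _) = irrefl G x≡y g

complete : (n : ℕ) → Graph n
complete n .Adj x y = ¬ x ≡ y
complete n .Adj? x y = ¬? (x ≟ y)
complete n .symm x≢y y≡x = x≢y (sym y≡x)
complete n .irrefl x≡y x≢y = x≢y x≡y

-- The complete bipartite graph with partite sets A and B, as a spanning graph
-- on Fin n; the vertices outside A ∪ B are isolated.
completeBipartite : (A B : Subset n) → Empty (A ∩ B) → Graph n
completeBipartite A B A∩B=∅ .Adj x y = (x ∈ A × y ∈ B) ⊎ (x ∈ B × y ∈ A)
completeBipartite A B A∩B=∅ .Adj? x y =
  ((x ∈? A) ×-dec (y ∈? B)) ⊎-dec ((x ∈? B) ×-dec (y ∈? A))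
completeBipartite A B A∩B=∅ .symm (inj₁ (x∈A , y∈B)) = inj₂ (y∈B , x∈A)
completeBipartite A B A∩B=∅ .symm (inj₂ (x∈B , y∈A)) = inj₁ (y∈A , x∈B)
completeBipartite A B A∩B=∅ .irrefl refl (inj₁ (x∈A , x∈B)) =
  A∩B=∅ (_ , x∈p∩q⁺ (x∈A , x∈B))
completeBipartite A B A∩B=∅ .irrefl refl (inj₂ (x∈B , x∈A)) =
  A∩B=∅ (_ , x∈p∩q⁺ (x∈A , x∈B))

-- The matching is given by the spanning graph M whose edges it consists of.
-- W is the vertex set to be covered: H may have further, isolated vertices.
IsPerfectMatching : (M H : Graph n) (W : Subset n) → Set
IsPerfectMatching M H W = M ⊑ H × (∀ x → x ∈ W → deg M x ≡ 1)

IsCompleteMinusBipartiteButMatching : Graph n → ℕ → Set₁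
IsCompleteMinusBipartiteButMatching {n} G k =
  ∃[ A ] ∃[ B ] Σ (Empty (A ∩ B)) λ A∩B=∅ →
    let K = completeBipartite A B A∩B=∅ in
    ∣ A ∣ ≡ k × ∣ B ∣ ≡ k ×
    Σ (Graph n) λ M → IsPerfectMatching M K (A ∪ B) × G ≐ complete n ∖ (K ∖ M)

{-# OPTIONS --safe #-}
module Submission where

-- Let A be the complement of a minimum ESD-set S, and for u ∈ A let f u ∈ S be
-- a vertex whose only neighbour in A is u.  Then B = { f u ∣ u ∈ A } is disjoint
-- from A, the edges u — f u form a perfect matching M between A and B, and every
-- edge of K_{A,B} ∖ M is a non-edge of G.  Since K_{A,B} ∖ M has k² - k edges for
-- k = |A|, this is the bound, and in the case of equality the non-edges of G are exactly
-- the edges of K_{A,B} ∖ M.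

open import Defs
open import Data.Nat.Base using (ℕ; _∸_)
open import Data.Nat.Combinatorics using (_C_)
open import Data.Integer.Base using (+_; _-_; _*_; _≤_; 1ℤ)
open import Data.Product.Base using (_×_)
open import Function.Bundles using (_⇔_)
open import Relation.Binary.PropositionalEquality using (_≡_)

open import Data.Bool.Base using (if_then_else_; true; false)
open import Data.Empty using (⊥-elim)
open import Data.Fin.Base using (Fin; zero; suc; _<_)
open import Data.Fin.Properties using (_≟_; _<?_; any?; <-cmp; <-asym)
open import Data.Fin.Subset
  using (Subset; inside; outside; _∈_; _∩_; _∪_; ∁; ⁅_⁆; ∣_∣; Empty)
open import Data.Fin.Subset.Properties
  using (_∈?_; x∈p∩q⁺; x∈p∩q⁻; x∈p∪q⁺; x∈p∪q⁻; x∈∁p⇒x∉p; x∉p⇒x∈∁p; x∈⁅x⁆;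
         x∈⁅y⁆⇒x≡y; ∣⁅x⁆∣≡1; ∣∁p∣≡n∸∣p∣; ∣p∣≤n; ∣⊥∣≡0; Empty-unique; ⊆-antisym)
open import Data.List.Base as List using (length; filter; cartesianProduct)
open import Data.List.Properties using (filter-++; length-++; map-tabulate)
open import Data.Nat.Base as ℕ using (zero; suc)
import Data.Nat.Properties as ℕ
open import Data.Nat.Combinatorics using (nC1≡n; nCk+nC[k+1]≡[n+1]C[k+1])
open import Data.Nat.Tactic.RingSolver using (solve-∀)
open import Data.Integer.Base using (+≤+)
import Data.Integer.Properties as ℤ
open import Data.Product.Base using (∃-syntax; _,_; proj₁; proj₂)
open import Data.Sum.Base as Sum using (_⊎_; inj₁; inj₂; [_,_])
open import Data.Vec.Base as Vec using ([]; _∷_)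
open import Data.Vec.Properties using ([]=⇒lookup; lookup⇒[]=; lookup∘tabulate)
open import Function.Base using (_∘_; id; case_of_)
open import Function.Bundles using (mk⇔; Equivalence)
open import Relation.Binary.Definitions using (tri<; tri≈; tri>)
open import Relation.Binary.PropositionalEquality
  using (refl; sym; trans; cong; cong₂; subst; module ≡-Reasoning)
open import Relation.Nullary using (¬_; Dec; does; yes; no)
open import Relation.Nullary.Decidable
  using (_×-dec_; _⊎-dec_; dec-true; dec-false; does-⇔; decidable-stable)
open import Relation.Unary using (Pred; Decidable)
open import Level using (0ℓ)

open import Algebra.Properties.Semiring.Sum ℕ.+-*-semiring
  using (sum; sum-syntax; sum-cong-≗; ∑-distrib-+; ∑-comm; *-distribˡ-sum; *-distribʳ-sum)

open Equivalence using (to; from)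
open ≡-Reasoning

private variable
  n : ℕ
  P Q R : Set

-- Sums of indicator functions

1[_] : Dec P → ℕ
1[ p? ] = if does p? then 1 else 0

1[]-yes : (p? : Dec P) → P → 1[ p? ] ≡ 1
1[]-yes p? p rewrite dec-true p? p = refl

1[]-no : (p? : Dec P) → ¬ P → 1[ p? ] ≡ 0
1[]-no p? ¬p rewrite dec-false p? ¬p = refl

1[]-cong : (p? : Dec P) (q? : Dec Q) → P ⇔ Q → 1[ p? ] ≡ 1[ q? ]
1[]-cong p? q? P⇔Q = cong (if_then 1 else 0) (does-⇔ P⇔Q p? q?)

1[]-× : (p? : Dec P) (q? : Dec Q) → 1[ p? ×-dec q? ] ≡ 1[ p? ] ℕ.* 1[ q? ]
1[]-× (no _)  q? = refl
1[]-× (yes _) q? = sym (ℕ.+-identityʳ 1[ q? ])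

1[]-⊎ : (p? : Dec P) (q? : Dec Q) (r? : Dec R) → P ⇔ (Q ⊎ R) → ¬ (Q × R) →
        1[ p? ] ≡ 1[ q? ] ℕ.+ 1[ r? ]
1[]-⊎ p? (yes q) (yes r) P⇔Q⊎R ¬Q×R = ⊥-elim (¬Q×R (q , r))
1[]-⊎ p? (yes q) (no ¬r) P⇔Q⊎R ¬Q×R = 1[]-yes p? (from P⇔Q⊎R (inj₁ q))
1[]-⊎ p? (no ¬q) (yes r) P⇔Q⊎R ¬Q×R = 1[]-yes p? (from P⇔Q⊎R (inj₂ r))
1[]-⊎ p? (no ¬q) (no ¬r) P⇔Q⊎R ¬Q×R = 1[]-no p? ([ ¬q , ¬r ] ∘ to P⇔Q⊎R)

∑-const : ∀ n c → ∑[ i < n ] c ≡ n ℕ.* c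
∑-const zero    c = refl
∑-const (suc n) c = cong (c ℕ.+_) (∑-const n c)

∑≡0⇒≡0 : (t : Fin n → ℕ) → sum t ≡ 0 → ∀ i → t i ≡ 0
∑≡0⇒≡0 t ∑≡0 zero    = ℕ.m+n≡0⇒m≡0 (t zero) ∑≡0
∑≡0⇒≡0 t ∑≡0 (suc i) = ∑≡0⇒≡0 (t ∘ suc) (ℕ.m+n≡0⇒n≡0 (t zero) ∑≡0) i

∣p∣≡∑ : (p : Subset n) → ∣ p ∣ ≡ ∑[ x < n ] 1[ x ∈? p ]
∣p∣≡∑ []            = refl
∣p∣≡∑ (inside  ∷ p) = cong suc (∣p∣≡∑ p)
∣p∣≡∑ (outside ∷ p) = ∣p∣≡∑ p

-- The sum is compared with the one counting the singleton `⁅ x ⁆`. It later yields the degree 1 of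
-- matched vertices.
∑-unique : {P : Pred (Fin n) 0ℓ} (P? : Decidable P) (x : Fin n) →
           (∀ y → P y ⇔ y ≡ x) → ∑[ y < n ] 1[ P? y ] ≡ 1
∑-unique {n} P? x P⇔≡x = begin
  ∑[ y < n ] 1[ P? y ]         ≡⟨ sum-cong-≗ (λ y → 1[]-cong (P? y) (y ∈? ⁅ x ⁆) (mk⇔
                                    (λ py → subst (_∈ ⁅ x ⁆) (sym (to (P⇔≡x y) py)) (x∈⁅x⁆ x))
                                    (from (P⇔≡x y) ∘ x∈⁅y⁆⇒x≡y x))) ⟩
  ∑[ y < n ] 1[ y ∈? ⁅ x ⁆ ]   ≡⟨ ∣p∣≡∑ ⁅ x ⁆ ⟨
  ∣ ⁅ x ⁆ ∣                    ≡⟨ ∣⁅x⁆∣≡1 x ⟩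
  1                            ∎

∈-tabulate : {P : Pred (Fin n) 0ℓ} (P? : Decidable P) (x : Fin n) →
             x ∈ Vec.tabulate (does ∘ P?) ⇔ P x
∈-tabulate P? x = mk⇔ ⇒ ⇐
  where
  ⇒ : x ∈ Vec.tabulate (does ∘ P?) → _
  ⇒ x∈ with P? x | trans (sym (lookup∘tabulate (does ∘ P?) x)) ([]=⇒lookup x∈)
  ... | yes px | _ = px
  ⇐ : _ → x ∈ Vec.tabulate (does ∘ P?)
  ⇐ px = lookup⇒[]= x _ (trans (lookup∘tabulate (does ∘ P?) x) (dec-true (P? x) px))

module _ {A : Set} {P : Pred A 0ℓ} (P? : Decidable P) where

  length-filter-tabulate : (f : Fin n → A) →
    length (filter P? (List.tabulate f)) ≡ ∑[ i < n ] 1[ P? (f i) ]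
  length-filter-tabulate {zero}  f = refl
  length-filter-tabulate {suc n} f
    with does (P? (f zero)) | length-filter-tabulate (f ∘ suc)
  ... | true  | eq = cong suc eq
  ... | false | eq = eq

-- Turns `size`, the length of a filtered list of pairs, into a double sum. The enumerations `f` and
-- `g` are arbitrary because the induction passes from `f` to `f ∘ suc`.
length-filter-cartesianProduct : ∀ {A B : Set} {m} {P : Pred (A × B) 0ℓ} (P? : Decidable P)
  (f : Fin m → A) (g : Fin n → B) →
  length (filter P? (cartesianProduct (List.tabulate f) (List.tabulate g)))
    ≡ ∑[ i < m ] ∑[ j < n ] 1[ P? (f i , g j) ]
length-filter-cartesianProduct {m = zero}  P? f g = refl
length-filter-cartesianProduct {n} {m = suc m} P? f g = begin
  length (filter P? (row List.++ rest))                    ≡⟨ cong length (filter-++ P? row rest) ⟩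
  length (filter P? row List.++ filter P? rest)            ≡⟨ length-++ (filter P? row) ⟩
  length (filter P? row) ℕ.+ length (filter P? rest)       ≡⟨ cong₂ ℕ._+_
    (trans (cong (length ∘ filter P?) (map-tabulate g (f zero ,_)))
           (length-filter-tabulate P? (λ j → f zero , g j)))
    (length-filter-cartesianProduct P? (f ∘ suc) g) ⟩
  ∑[ i < suc m ] ∑[ j < n ] 1[ P? (f i , g j) ]            ∎
  where
  row  = List.map (f zero ,_) (List.tabulate g)
  rest = cartesianProduct (List.tabulate (f ∘ suc)) (List.tabulate g)

-- Degrees and sizes

∈N : (G : Graph n) (v u : Fin n) → u ∈ N G v ⇔ Adj G v u
∈N G v = ∈-tabulate (Adj? G v)

deg≡∑ : (G : Graph n) (v : Fin n) → deg G v ≡ ∑[ u < n ] 1[ Adj? G v u ]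
deg≡∑ G v = trans (∣p∣≡∑ (N G v))
  (sum-cong-≗ λ u → 1[]-cong (u ∈? N G v) (Adj? G v u) (∈N G v u))

-- The indicator of adjacency splits into the cases `v < u` and `u < v`. The first sums to the
-- number of listed edges `E`, and so does the second once the two summations are exchanged.
handshake : (G : Graph n) → ∑[ v < n ] deg G v ≡ 2 ℕ.* size G
handshake {n} G = begin
  ∑[ v < n ] deg G v                         ≡⟨ sum-cong-≗ (λ v → trans (deg≡∑ G v) (trans
                                                  (sum-cong-≗ (split v))
                                                  (∑-distrib-+ (λ u → e v u) (λ u → e u v)))) ⟩
  ∑[ v < n ] (∑[ u < n ] e v u ℕ.+ ∑[ u < n ] e u v)
                                             ≡⟨ ∑-distrib-+ (λ v → ∑[ u < n ] e v u) (λ v → ∑[ u < n ] e u v) ⟩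
  E ℕ.+ ∑[ v < n ] ∑[ u < n ] e u v          ≡⟨ cong (E ℕ.+_) (∑-comm (λ v u → e u v)) ⟩
  E ℕ.+ E                                    ≡⟨ cong (E ℕ.+_) (ℕ.+-identityʳ E) ⟨
  2 ℕ.* E                                    ≡⟨ cong (2 ℕ.*_) (length-filter-cartesianProduct
                                                  (λ (i , j) → (i <? j) ×-dec Adj? G i j) id id) ⟨
  2 ℕ.* size G                               ∎
  where
  e : Fin n → Fin n → ℕ
  e i j = 1[ (i <? j) ×-dec Adj? G i j ]
  E = ∑[ i < n ] ∑[ j < n ] e i j

  order : ∀ v u → Adj G v u → (v < u × Adj G v u) ⊎ (u < v × Adj G u v)
  order v u a with <-cmp v u
  ... | tri< v<u _ _ = inj₁ (v<u , a)
  ... | tri≈ _ v≡u _ = ⊥-elim (irrefl G v≡u a)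
  ... | tri> _ _ u<v = inj₂ (u<v , symm G a)

  split : ∀ v u → 1[ Adj? G v u ] ≡ e v u ℕ.+ e u v
  split v u = 1[]-⊎ (Adj? G v u) ((v <? u) ×-dec Adj? G v u) ((u <? v) ×-dec Adj? G u v)
    (mk⇔ (order v u) [ proj₂ , symm G ∘ proj₂ ])
    (λ ((v<u , _) , (u<v , _)) → <-asym v<u u<v)

-- Reduces counting edges to summing degrees, which does not refer to the ordering used in `edges`.
size-from-degrees : (G : Graph n) (s : ℕ) → ∑[ v < n ] deg G v ≡ 2 ℕ.* s → size G ≡ s
size-from-degrees G s eq = ℕ.*-cancelˡ-≡ (size G) s 2 (trans (sym (handshake G)) eq)

size-cong : (G H : Graph n) → G ≐ H → size G ≡ size H
size-cong {n} G H G≐H = size-from-degrees G (size H) (begin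
  ∑[ v < n ] deg G v   ≡⟨ sum-cong-≗ (λ v → trans (deg≡∑ G v) (trans
                            (sum-cong-≗ λ u → 1[]-cong (Adj? G v u) (Adj? H v u) (G≐H v u))
                            (sym (deg≡∑ H v)))) ⟩
  ∑[ v < n ] deg H v   ≡⟨ handshake H ⟩
  2 ℕ.* size H         ∎)

-- Each neighbour in `G` is a neighbour in exactly one of `H` and `G ∖ H`, so degrees add vertex by
-- vertex.
size-∖ : (G H : Graph n) → H ⊑ G → size G ≡ size H ℕ.+ size (G ∖ H)
size-∖ {n} G H H⊑G = size-from-degrees G _ (begin
  ∑[ v < n ] deg G v                                  ≡⟨ sum-cong-≗ deg-∖ ⟩
  ∑[ v < n ] (deg H v ℕ.+ deg (G ∖ H) v)              ≡⟨ ∑-distrib-+ (deg H) (deg (G ∖ H)) ⟩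
  ∑[ v < n ] deg H v ℕ.+ ∑[ v < n ] deg (G ∖ H) v     ≡⟨ cong₂ ℕ._+_ (handshake H) (handshake (G ∖ H)) ⟩
  2 ℕ.* size H ℕ.+ 2 ℕ.* size (G ∖ H)                 ≡⟨ ℕ.*-distribˡ-+ 2 (size H) (size (G ∖ H)) ⟨
  2 ℕ.* (size H ℕ.+ size (G ∖ H))                     ∎)
  where
  split : ∀ v u → Adj G v u → Adj H v u ⊎ Adj (G ∖ H) v u
  split v u g with Adj? H v u
  ... | yes h = inj₁ h
  ... | no ¬h = inj₂ (g , ¬h)

  deg-∖ : ∀ v → deg G v ≡ deg H v ℕ.+ deg (G ∖ H) v
  deg-∖ v = begin
    deg G v                                                          ≡⟨ deg≡∑ G v ⟩
    ∑[ u < n ] 1[ Adj? G v u ]                                       ≡⟨ sum-cong-≗ (λ u →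
      1[]-⊎ (Adj? G v u) (Adj? H v u) (Adj? (G ∖ H) v u)
            (mk⇔ (split v u) [ H⊑G v u , proj₁ ]) (λ (h , (_ , ¬h)) → ¬h h)) ⟩
    ∑[ u < n ] (1[ Adj? H v u ] ℕ.+ 1[ Adj? (G ∖ H) v u ])           ≡⟨ ∑-distrib-+ (1[_] ∘ Adj? H v) (1[_] ∘ Adj? (G ∖ H) v) ⟩
    ∑[ u < n ] 1[ Adj? H v u ] ℕ.+ ∑[ u < n ] 1[ Adj? (G ∖ H) v u ]  ≡⟨ cong₂ ℕ._+_ (deg≡∑ H v) (deg≡∑ (G ∖ H) v) ⟨
    deg H v ℕ.+ deg (G ∖ H) v                                        ∎

size-mono : (G H : Graph n) → H ⊑ G → size H ℕ.≤ size G
size-mono G H H⊑G = ℕ.m+n≤o⇒m≤o (size H) (ℕ.≤-reflexive (sym (size-∖ G H H⊑G)))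

-- A vanishing sum of naturals has only zero terms: first every degree vanishes, then every
-- indicator of adjacency.
size≡0⇒¬Adj : (G : Graph n) → size G ≡ 0 → ∀ x y → ¬ Adj G x y
size≡0⇒¬Adj {n} G eq x y a = case trans (sym (1[]-yes (Adj? G x y) a)) 1[Adj]≡0 of λ ()
  where
  deg≡0 : deg G x ≡ 0
  deg≡0 = ∑≡0⇒≡0 (deg G) (trans (handshake G) (cong (2 ℕ.*_) eq)) x
  1[Adj]≡0 : 1[ Adj? G x y ] ≡ 0
  1[Adj]≡0 = ∑≡0⇒≡0 (1[_] ∘ Adj? G x) (trans (sym (deg≡∑ G x)) deg≡0) y

-- Equal sizes leave no edge for the difference of the two graphs. This is how equality in the bound
-- forces the structure of the graph.
size≡⇒⊒ : (G H : Graph n) → H ⊑ G → size G ≡ size H → G ⊑ H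
size≡⇒⊒ G H H⊑G eq x y g = decidable-stable (Adj? H x y) λ ¬h →
  size≡0⇒¬Adj (G ∖ H) size[G∖H]≡0 x y (g , ¬h)
  where
  size[G∖H]≡0 : size (G ∖ H) ≡ 0
  size[G∖H]≡0 = ℕ.+-cancelˡ-≡ (size H) _ 0
    (trans (sym (size-∖ G H H⊑G)) (trans eq (sym (ℕ.+-identityʳ (size H)))))

size-complete : ∀ n → size (complete n) ≡ n C 2
size-complete n = size-from-degrees (complete n) (n C 2) (begin
  ∑[ v < n ] deg (complete n) v    ≡⟨ sum-cong-≗ deg-complete ⟩
  ∑[ v < n ] (n ∸ 1)               ≡⟨ ∑-const n (n ∸ 1) ⟩
  n ℕ.* (n ∸ 1)                    ≡⟨ n[n∸1]≡2nC2 n ⟩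
  2 ℕ.* (n C 2)                      ∎)
  where
  n[n∸1]≡2nC2 : ∀ n → n ℕ.* (n ∸ 1) ≡ 2 ℕ.* (n C 2)
  n[n∸1]≡2nC2 zero          = refl
  n[n∸1]≡2nC2 (suc zero)    = refl
  -- The summands 2(m + 1) and (m + 1)m of (m + 2)(m + 1) are twice the two terms of Pascal's rule
  -- for `suc (suc m) C 2`.
  n[n∸1]≡2nC2 (suc (suc m)) = begin
    suc (suc m) ℕ.* suc m                  ≡⟨ expand m ⟩
    2 ℕ.* suc m ℕ.+ suc m ℕ.* m            ≡⟨ cong₂ (λ a b → 2 ℕ.* a ℕ.+ b) (sym (nC1≡n (suc m))) (n[n∸1]≡2nC2 (suc m)) ⟩
    2 ℕ.* (suc m C 1) ℕ.+ 2 ℕ.* (suc m C 2) ≡⟨ ℕ.*-distribˡ-+ 2 (suc m C 1) (suc m C 2) ⟨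
    2 ℕ.* ((suc m C 1) ℕ.+ (suc m C 2))       ≡⟨ cong (2 ℕ.*_) (nCk+nC[k+1]≡[n+1]C[k+1] (suc m) 1) ⟩
    2 ℕ.* (suc (suc m) C 2)                ∎
    where
    expand : ∀ m → suc (suc m) ℕ.* suc m ≡ 2 ℕ.* suc m ℕ.+ suc m ℕ.* m
    expand = solve-∀

  deg-complete : ∀ v → deg (complete n) v ≡ n ∸ 1
  deg-complete v = begin
    -- The neighbourhood of `v` is the complement of `⁅ v ⁆`.
    deg (complete n) v   ≡⟨ cong ∣_∣ (⊆-antisym
      (λ u∈N → x∉p⇒x∈∁p λ u∈⁅v⁆ → to (∈N (complete n) v _) u∈N (sym (x∈⁅y⁆⇒x≡y v u∈⁅v⁆)))
      (λ u∈∁ → from (∈N (complete n) v _) λ where refl → x∈∁p⇒x∉p u∈∁ (x∈⁅x⁆ v))) ⟩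
    ∣ ∁ ⁅ v ⁆ ∣          ≡⟨ ∣∁p∣≡n∸∣p∣ ⁅ v ⁆ ⟩
    n ∸ ∣ ⁅ v ⁆ ∣        ≡⟨ cong (n ∸_) (∣⁅x⁆∣≡1 v) ⟩
    n ∸ 1                ∎

-- Complete bipartite graphs and their perfect matchings

module _ (A B : Subset n) (A∩B=∅ : Empty (A ∩ B)) where

  private
    K = completeBipartite A B A∩B=∅

  -- A vertex has degree `∣ B ∣` in `A`, `∣ A ∣` in `B` and 0 elsewhere. The formula in `deg-K`
  -- covers the three cases at once, as `A` and `B` are disjoint.
  size-completeBipartite : size K ≡ ∣ A ∣ ℕ.* ∣ B ∣
  size-completeBipartite = size-from-degrees K _ (begin
    ∑[ x < n ] deg K x                            ≡⟨ sum-cong-≗ deg-K ⟩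
    ∑[ x < n ] (a x ℕ.* ∣ B ∣ ℕ.+ b x ℕ.* ∣ A ∣)  ≡⟨ ∑-distrib-+ (λ x → a x ℕ.* ∣ B ∣) (λ x → b x ℕ.* ∣ A ∣) ⟩
    ∑[ x < n ] (a x ℕ.* ∣ B ∣) ℕ.+ ∑[ x < n ] (b x ℕ.* ∣ A ∣)
                                                  ≡⟨ cong₂ ℕ._+_ (*-distribʳ-sum ∣ B ∣ a) (*-distribʳ-sum ∣ A ∣ b) ⟨
    sum a ℕ.* ∣ B ∣ ℕ.+ sum b ℕ.* ∣ A ∣           ≡⟨ cong₂ (λ p q → p ℕ.* ∣ B ∣ ℕ.+ q ℕ.* ∣ A ∣) (∣p∣≡∑ A) (∣p∣≡∑ B) ⟨
    ∣ A ∣ ℕ.* ∣ B ∣ ℕ.+ ∣ B ∣ ℕ.* ∣ A ∣           ≡⟨ double ∣ A ∣ ∣ B ∣ ⟩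
    2 ℕ.* (∣ A ∣ ℕ.* ∣ B ∣)                       ∎)
    where
    a b : Fin n → ℕ
    a x = 1[ x ∈? A ]
    b x = 1[ x ∈? B ]

    double : ∀ p q → p ℕ.* q ℕ.+ q ℕ.* p ≡ 2 ℕ.* (p ℕ.* q)
    double = solve-∀

    deg-K : ∀ x → deg K x ≡ a x ℕ.* ∣ B ∣ ℕ.+ b x ℕ.* ∣ A ∣
    deg-K x = begin
      deg K x                                                       ≡⟨ deg≡∑ K x ⟩
      ∑[ y < n ] 1[ Adj? K x y ]                                    ≡⟨ sum-cong-≗ (λ y → trans
        (1[]-⊎ (Adj? K x y) ((x ∈? A) ×-dec (y ∈? B)) ((x ∈? B) ×-dec (y ∈? A))
          (mk⇔ id id) (λ ((x∈A , _) , (x∈B , _)) → A∩B=∅ (x , x∈p∩q⁺ (x∈A , x∈B))))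
        (cong₂ ℕ._+_ (1[]-× (x ∈? A) (y ∈? B)) (1[]-× (x ∈? B) (y ∈? A)))) ⟩
      ∑[ y < n ] (a x ℕ.* b y ℕ.+ b x ℕ.* a y)                      ≡⟨ ∑-distrib-+ (λ y → a x ℕ.* b y) (λ y → b x ℕ.* a y) ⟩
      ∑[ y < n ] (a x ℕ.* b y) ℕ.+ ∑[ y < n ] (b x ℕ.* a y)         ≡⟨ cong₂ ℕ._+_ (*-distribˡ-sum (a x) b) (*-distribˡ-sum (b x) a) ⟨
      a x ℕ.* sum b ℕ.+ b x ℕ.* sum a                               ≡⟨ cong₂ (λ p q → a x ℕ.* q ℕ.+ b x ℕ.* p) (∣p∣≡∑ A) (∣p∣≡∑ B) ⟨
      a x ℕ.* ∣ B ∣ ℕ.+ b x ℕ.* ∣ A ∣                               ∎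

  module _ (M : Graph n) (M-perfect : IsPerfectMatching M K (A ∪ B)) where

    private
      M⊑K = proj₁ M-perfect
      deg-M = proj₂ M-perfect

      -- Each vertex of `p` contributes exactly one pair, namely itself with its partner under `M`.
      ∣∣≡∑M : (p : Subset n) → (∀ x → x ∈ p → deg M x ≡ 1) →
              ∣ p ∣ ≡ ∑[ x < n ] ∑[ y < n ] 1[ (x ∈? p) ×-dec Adj? M x y ]
      ∣∣≡∑M p deg≡1 = trans (∣p∣≡∑ p) (sum-cong-≗ λ x → begin
        1[ x ∈? p ]                                          ≡⟨ weight x ⟩
        1[ x ∈? p ] ℕ.* deg M x                              ≡⟨ cong (1[ x ∈? p ] ℕ.*_) (deg≡∑ M x) ⟩
        1[ x ∈? p ] ℕ.* ∑[ y < n ] 1[ Adj? M x y ]           ≡⟨ *-distribˡ-sum 1[ x ∈? p ] (1[_] ∘ Adj? M x) ⟩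
        ∑[ y < n ] (1[ x ∈? p ] ℕ.* 1[ Adj? M x y ])         ≡⟨ sum-cong-≗ (λ y → 1[]-× (x ∈? p) (Adj? M x y)) ⟨
        ∑[ y < n ] 1[ (x ∈? p) ×-dec Adj? M x y ]            ∎)
        where
        weight : ∀ x → 1[ x ∈? p ] ≡ 1[ x ∈? p ] ℕ.* deg M x
        weight x with x ∈? p
        ... | no _    = refl
        ... | yes x∈p = sym (trans (ℕ.*-identityˡ (deg M x)) (deg≡1 x x∈p))

      A-to-B : ∀ {x y} → x ∈ A → Adj M x y → y ∈ B
      A-to-B {x} {y} x∈A m with M⊑K x y m
      ... | inj₁ (_ , y∈B) = y∈B
      ... | inj₂ (x∈B , _) = ⊥-elim (A∩B=∅ (x , x∈p∩q⁺ (x∈A , x∈B)))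

      B-to-A : ∀ {x y} → x ∈ B → Adj M x y → y ∈ A
      B-to-A {x} {y} x∈B m with M⊑K x y m
      ... | inj₁ (x∈A , _) = ⊥-elim (A∩B=∅ (x , x∈p∩q⁺ (x∈A , x∈B)))
      ... | inj₂ (_ , y∈A) = y∈A

    -- Double counting: the matching edges are counted once from their ends in `A` and once from
    -- their ends in `B`.
    perfectMatching⇒∣A∣≡∣B∣ : ∣ A ∣ ≡ ∣ B ∣
    perfectMatching⇒∣A∣≡∣B∣ = begin
      ∣ A ∣                                                        ≡⟨ ∣∣≡∑M A (λ x x∈A → deg-M x (x∈p∪q⁺ (inj₁ x∈A))) ⟩
      ∑[ x < n ] ∑[ y < n ] 1[ (x ∈? A) ×-dec Adj? M x y ]         ≡⟨ ∑-comm (λ x y → 1[ (x ∈? A) ×-dec Adj? M x y ]) ⟩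
      ∑[ y < n ] ∑[ x < n ] 1[ (x ∈? A) ×-dec Adj? M x y ]         ≡⟨ sum-cong-≗ (λ y → sum-cong-≗ λ x →
        1[]-cong ((x ∈? A) ×-dec Adj? M x y) ((y ∈? B) ×-dec Adj? M y x) (mk⇔
          (λ (x∈A , m) → A-to-B x∈A m , symm M m)
          (λ (y∈B , m) → B-to-A y∈B m , symm M m))) ⟩
      ∑[ y < n ] ∑[ x < n ] 1[ (y ∈? B) ×-dec Adj? M y x ]         ≡⟨ ∣∣≡∑M B (λ x x∈B → deg-M x (x∈p∪q⁺ (inj₂ x∈B))) ⟨
      ∣ B ∣                                                        ∎

    -- Vertices of `A` and of `B` have degree 1 in `M` and all others are isolated, so the degrees
    -- sum to `∣ A ∣ ℕ.+ ∣ B ∣`.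
    size-perfectMatching : size M ≡ ∣ A ∣
    size-perfectMatching = size-from-degrees M ∣ A ∣ (begin
      ∑[ x < n ] deg M x                                     ≡⟨ sum-cong-≗ deg≡1[] ⟩
      ∑[ x < n ] (1[ x ∈? A ] ℕ.+ 1[ x ∈? B ])               ≡⟨ ∑-distrib-+ (λ x → 1[ x ∈? A ]) (λ x → 1[ x ∈? B ]) ⟩
      ∑[ x < n ] 1[ x ∈? A ] ℕ.+ ∑[ x < n ] 1[ x ∈? B ]      ≡⟨ cong₂ ℕ._+_ (∣p∣≡∑ A) (∣p∣≡∑ B) ⟨
      ∣ A ∣ ℕ.+ ∣ B ∣                                        ≡⟨ cong (∣ A ∣ ℕ.+_) (trans (ℕ.+-identityʳ ∣ A ∣) perfectMatching⇒∣A∣≡∣B∣) ⟨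
      2 ℕ.* ∣ A ∣                                            ∎)
      where
      isolated : ∀ x → ¬ x ∈ A → ¬ x ∈ B → deg M x ≡ 0
      isolated x x∉A x∉B = trans (cong ∣_∣ (Empty-unique λ (y , y∈N) →
        [ x∉A ∘ proj₁ , x∉B ∘ proj₁ ] (M⊑K x y (to (∈N M x y) y∈N)))) (∣⊥∣≡0 n)

      deg≡1[] : ∀ x → deg M x ≡ 1[ x ∈? A ] ℕ.+ 1[ x ∈? B ]
      deg≡1[] x with x ∈? A | x ∈? B
      ... | yes x∈A | yes x∈B = ⊥-elim (A∩B=∅ (x , x∈p∩q⁺ (x∈A , x∈B)))
      ... | yes x∈A | no  _   = deg-M x (x∈p∪q⁺ (inj₁ x∈A))
      ... | no  _   | yes x∈B = deg-M x (x∈p∪q⁺ (inj₂ x∈B))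
      ... | no  x∉A | no  x∉B = isolated x x∉A x∉B

    size-bipartite∖matching : size (K ∖ M) ≡ ∣ A ∣ ℕ.* (∣ A ∣ ∸ 1)
    size-bipartite∖matching = begin
      size (K ∖ M)                              ≡⟨ ℕ.m+n∸m≡n (size M) (size (K ∖ M)) ⟨
      size M ℕ.+ size (K ∖ M) ∸ size M          ≡⟨ cong (_∸ size M) (size-∖ K M M⊑K) ⟨
      size K ∸ size M                           ≡⟨ cong₂ _∸_
        (trans size-completeBipartite (cong (∣ A ∣ ℕ.*_) (sym perfectMatching⇒∣A∣≡∣B∣)))
        -- With `∣ A ∣` written as `∣ A ∣ ℕ.* 1`, multiplication distributes over the truncated
        -- subtraction, also when `A` is empty.
        (trans size-perfectMatching (sym (ℕ.*-identityʳ ∣ A ∣))) ⟩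
      ∣ A ∣ ℕ.* ∣ A ∣ ∸ ∣ A ∣ ℕ.* 1             ≡⟨ ℕ.*-distribˡ-∸ ∣ A ∣ ∣ A ∣ 1 ⟨
      ∣ A ∣ ℕ.* (∣ A ∣ ∸ 1)                     ∎

-- The matching of an end super dominating set

module _ (G : Graph n) (S : Subset n)
         (dominated : ∀ u → u ∈ ∁ S → ∃[ v ] (v ∈ S × N G v ∩ ∁ S ≡ ⁅ u ⁆)) where

  private
    A = ∁ S

    -- The value outside A is irrelevant.
    f : Fin n → Fin n
    f u with u ∈? A
    ... | yes u∈A = proj₁ (dominated u u∈A)
    ... | no  _   = u

    -- Any membership proof will do here: `f u` is built from the one returned by `u ∈? A`, so its
    -- value depends on `u` alone.
    f-spec : ∀ {u} → u ∈ A → f u ∈ S × N G (f u) ∩ A ≡ ⁅ u ⁆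
    f-spec {u} u∈A with u ∈? A
    ... | yes u∈A′ = proj₂ (dominated u u∈A′)
    ... | no  u∉A  = ⊥-elim (u∉A u∈A)

    f-private : ∀ {u w} → u ∈ A → w ∈ A → Adj G (f u) w → w ≡ u
    f-private {u} {w} u∈A w∈A a = x∈⁅y⁆⇒x≡y u
      (subst (w ∈_) (proj₂ (f-spec u∈A)) (x∈p∩q⁺ (from (∈N G (f u) w) a , w∈A)))

    f-Adj : ∀ {u} → u ∈ A → Adj G (f u) u
    f-Adj {u} u∈A = to (∈N G (f u) u)
      (proj₁ (x∈p∩q⁻ (N G (f u)) A (subst (u ∈_) (sym (proj₂ (f-spec u∈A))) (x∈⁅x⁆ u))))

    -- The vertex `f u` is adjacent to `u`; if it is also `f w`, then its only neighbour in `A` is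
    -- `w`.
    f-injective : ∀ {u w} → u ∈ A → w ∈ A → f u ≡ f w → u ≡ w
    f-injective {u} u∈A w∈A eq = f-private w∈A u∈A (subst (λ v → Adj G v u) eq (f-Adj u∈A))

    image? : Decidable (λ v → ∃[ u ] (u ∈ A × v ≡ f u))
    image? v = any? λ u → (u ∈? A) ×-dec (v ≟ f u)

  partner : Subset n
  partner = Vec.tabulate (does ∘ image?)

  private
    B = partner

    f∈B : ∀ {u} → u ∈ A → f u ∈ B
    f∈B {u} u∈A = from (∈-tabulate image? (f u)) (u , u∈A , refl)

    f∉A : ∀ {u} → u ∈ A → ¬ f u ∈ A
    f∉A u∈A fu∈A = x∈∁p⇒x∉p fu∈A (proj₁ (f-spec u∈A))

    ∈B⇒∉A : ∀ {v} → v ∈ B → ¬ v ∈ A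
    ∈B⇒∉A {v} v∈B with to (∈-tabulate image? v) v∈B
    ... | u , u∈A , refl = f∉A u∈A

  A∩partner=∅ : Empty (∁ S ∩ partner)
  A∩partner=∅ (v , v∈A∩B) = let v∈A , v∈B = x∈p∩q⁻ A B v∈A∩B in ∈B⇒∉A v∈B v∈A

  private
    K = completeBipartite A B A∩partner=∅

  partnerMatching : Graph n
  partnerMatching .Adj x y = (x ∈ A × y ≡ f x) ⊎ (y ∈ A × x ≡ f y)
  partnerMatching .Adj? x y = ((x ∈? A) ×-dec (y ≟ f x)) ⊎-dec ((y ∈? A) ×-dec (x ≟ f y))
  partnerMatching .symm = Sum.swap
  partnerMatching .irrefl refl (inj₁ (x∈A , eq)) = f∉A x∈A (subst (_∈ A) eq x∈A)
  partnerMatching .irrefl refl (inj₂ (x∈A , eq)) = f∉A x∈A (subst (_∈ A) eq x∈A)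

  private
    M = partnerMatching

    M⊑K : M ⊑ K
    M⊑K x y (inj₁ (x∈A , refl)) = inj₁ (x∈A , f∈B x∈A)
    M⊑K x y (inj₂ (y∈A , refl)) = inj₂ (f∈B y∈A , y∈A)

    deg-unique : ∀ x z → (∀ y → Adj M x y ⇔ y ≡ z) → deg M x ≡ 1
    deg-unique x z M⇔ = trans (deg≡∑ M x) (∑-unique (Adj? M x) z M⇔)

    deg-A : ∀ x → x ∈ A → deg M x ≡ 1
    deg-A x x∈A = deg-unique x (f x) λ y → mk⇔
      [ proj₂ , (λ (y∈A , x≡fy) → ⊥-elim (f∉A y∈A (subst (_∈ A) x≡fy x∈A))) ]
      (λ y≡fx → inj₁ (x∈A , y≡fx))

    deg-B : ∀ x → x ∈ B → deg M x ≡ 1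
    deg-B x x∈B with to (∈-tabulate image? x) x∈B
    ... | u , u∈A , refl = deg-unique (f u) u λ y → mk⇔
      [ (λ (fu∈A , _) → ⊥-elim (f∉A u∈A fu∈A))
      -- Injectivity of `f` on `A` makes `u` the only vertex matched with `f u`.
      , (λ (y∈A , fu≡fy) → f-injective y∈A u∈A (sym fu≡fy)) ]
      (λ where refl → inj₂ (u∈A , refl))

  partnerMatching-perfect : IsPerfectMatching M K (∁ S ∪ partner)
  partnerMatching-perfect = M⊑K , λ x x∈A∪B → [ deg-A x , deg-B x ] (x∈p∪q⁻ A B x∈A∪B)

  private
    -- Let `y` be `f u`. If `x` were adjacent to it, then `x` would be `u`, the only neighbour of
    -- `f u` in `A`, and `x` and `y` would be matched.
    cross-nonadjacent : ∀ {x y} → x ∈ A → y ∈ B → ¬ Adj M x y → ¬ Adj G x y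
    cross-nonadjacent {x} {y} x∈A y∈B ¬m g with to (∈-tabulate image? y) y∈B
    ... | u , u∈A , refl with f-private u∈A x∈A (symm G g)
    ... | refl = ¬m (inj₁ (x∈A , refl))

  -- This inclusion carries the whole argument: comparing sizes gives the bound, and equal sizes
  -- turn it into an equality of graphs.
  nonedges : K ∖ M ⊑ complete n ∖ G
  nonedges x y (k , ¬m) = (λ x≡y → irrefl K x≡y k) , ¬g k
    where
    ¬g : Adj K x y → ¬ Adj G x y
    ¬g (inj₁ (x∈A , y∈B)) = cross-nonadjacent x∈A y∈B ¬m
    ¬g (inj₂ (x∈B , y∈A)) = cross-nonadjacent y∈A x∈B (¬m ∘ symm M) ∘ symm G

-- The bound and the extremal graphs, over the natural numbers

size+nonedges : (G : Graph n) → size G ℕ.+ size (complete n ∖ G) ≡ n C 2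
size+nonedges {n} G =
  trans (sym (size-∖ (complete n) G λ x y g x≡y → irrefl G x≡y g)) (size-complete n)

module _ (G : Graph n) (S : Subset n)
         (dom : ∀ u → u ∈ ∁ S → ∃[ v ] (v ∈ S × N G v ∩ ∁ S ≡ ⁅ u ⁆)) where

  private
    B   = partner G S dom
    dis = A∩partner=∅ G S dom
    M   = partnerMatching G S dom
    M-perfect = partnerMatching-perfect G S dom
    H   = completeBipartite (∁ S) B dis ∖ M
    k   = n ∸ ∣ S ∣

    ∣A∣≡k : ∣ ∁ S ∣ ≡ k
    ∣A∣≡k = ∣∁p∣≡n∸∣p∣ S

    size-H : size H ≡ k ℕ.* (k ∸ 1)
    size-H = trans (size-bipartite∖matching (∁ S) B dis M M-perfect)
                   (cong (λ a → a ℕ.* (a ∸ 1)) ∣A∣≡k)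

  -- The term `k ℕ.* (k ∸ 1)` stands on the left, so that truncated subtraction from `n C 2` cannot
  -- weaken the claim.
  size-bound : size G ℕ.+ k ℕ.* (k ∸ 1) ℕ.≤ n C 2
  size-bound = ℕ.≤-trans
    (ℕ.+-monoʳ-≤ (size G) (ℕ.≤-trans (ℕ.≤-reflexive (sym size-H))
                                     (size-mono (complete n ∖ G) H (nonedges G S dom))))
    (ℕ.≤-reflexive (size+nonedges G))

  size≡⇒extremal : size G ℕ.+ k ℕ.* (k ∸ 1) ≡ n C 2 → IsCompleteMinusBipartiteButMatching G k
  size≡⇒extremal eq = ∁ S , B , dis , ∣A∣≡k ,
    trans (sym (perfectMatching⇒∣A∣≡∣B∣ (∁ S) B dis M M-perfect)) ∣A∣≡k ,
    M , M-perfect , λ x y → mk⇔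
      (λ g → (λ x≡y → irrefl G x≡y g) , λ h → proj₂ (nonedges G S dom x y h) g)
      -- Adjacency is decidable, so it can be shown by contradiction: a non-edge of `G` would be an
      -- edge of `H`.
      (λ (x≢y , ¬h) → decidable-stable (Adj? G x y) λ ¬g → ¬h (nonedges⊑H x y (x≢y , ¬g)))
    where
    -- Cancelling `size G` shows that `G` has as many non-edges as `H` has edges, so the inclusion
    -- `nonedges` can be reversed.
    nonedges⊑H : complete n ∖ G ⊑ H
    nonedges⊑H = size≡⇒⊒ (complete n ∖ G) H (nonedges G S dom)
      (ℕ.+-cancelˡ-≡ (size G) _ _
        (trans (size+nonedges G) (trans (sym eq) (cong (size G ℕ.+_) (sym size-H)))))

-- The non-edges of `G` are the edges of a bipartite graph without a perfect matching, and these
-- have already been counted for arbitrary partite sets.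
extremal⇒size≡ : (G : Graph n) → ∀ {k} → IsCompleteMinusBipartiteButMatching G k →
                 size G ℕ.+ k ℕ.* (k ∸ 1) ≡ n C 2
extremal⇒size≡ {n} G (A , B′ , dis′ , refl , _ , M′ , M′-perfect , G≐) = begin
  size G ℕ.+ ∣ A ∣ ℕ.* (∣ A ∣ ∸ 1)        ≡⟨ cong₂ ℕ._+_ (size-cong G (complete n ∖ H′) G≐)
                                              (sym (size-bipartite∖matching A B′ dis′ M′ M′-perfect)) ⟩
  size (complete n ∖ H′) ℕ.+ size H′      ≡⟨ ℕ.+-comm (size (complete n ∖ H′)) (size H′) ⟩
  size H′ ℕ.+ size (complete n ∖ H′)      ≡⟨ size+nonedges H′ ⟩
  n C 2                                   ∎
  where
  H′ = completeBipartite A B′ dis′ ∖ M′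

-- From truncated subtraction to the integers

pos-∸ : ∀ {m n} → n ℕ.≤ m → + m - + n ≡ + (m ∸ n)
pos-∸ {m} {n} n≤m = trans (ℤ.m-n≡m⊖n m n) (ℤ.⊖-≥ n≤m)

-- At 0 the factors `+ k - 1ℤ` and `k ∸ 1` differ, but both products vanish.
k*[k-1] : ∀ k → + k * (+ k - 1ℤ) ≡ + (k ℕ.* (k ∸ 1))
k*[k-1] zero    = refl
k*[k-1] (suc k) = sym (ℤ.pos-* (suc k) k)

-- `E` stands for the extremal condition, which lies in `Set₁` because it asserts the existence of a
-- graph.
bound-in-ℤ : ∀ {m n g c} {E : Set₁} → let d = (n ∸ g) ℕ.* (n ∸ g ∸ 1) in
  g ℕ.≤ n → m ℕ.+ d ℕ.≤ c → (m ℕ.+ d ≡ c) ⇔ E →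
  let k = + n - + g in
  (+ m ≤ + c - k * (k - 1ℤ)) × ((+ m ≡ + c - k * (k - 1ℤ)) ⇔ E)
bound-in-ℤ {m} {n} {g} {c} g≤n m+d≤c tight
  -- Every integer difference becomes the image of a truncated one; for the outermost this requires
  -- `d ℕ.≤ c`, which follows from `m+d≤c`.
  rewrite pos-∸ g≤n | k*[k-1] (n ∸ g) | pos-∸ (ℕ.m+n≤o⇒n≤o m m+d≤c)
  = +≤+ (ℕ.m+n≤o⇒m≤o∸n m m+d≤c) , mk⇔
      (λ eq → to tight (trans (cong (ℕ._+ d) (ℤ.+-injective eq))
                              (ℕ.m∸n+n≡m (ℕ.m+n≤o⇒n≤o m m+d≤c))))
      (λ e → cong +_ (trans (sym (ℕ.m+n∸n≡m m d)) (cong (_∸ d) (from tight e))))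
  where
  d = (n ∸ g) ℕ.* (n ∸ g ∸ 1)

theorem5p1 : (n : ℕ) (G : Graph n) →
    let k     = + n - + γesp G
        bound = + (n C 2) - k * (k - 1ℤ)
    in (+ size G ≤ bound) × ((+ size G ≡ bound) ⇔ IsCompleteMinusBipartiteButMatching G (n ∸ γesp G))
theorem5p1 n G =
  -- By definition `γesp G` is `∣ S ∣` for this very `S`, so the results about `S` apply as they
  -- stand.
  let S , (dom , _) , _ = minimumESD G
  in bound-in-ℤ (∣p∣≤n S) (size-bound G S dom) (mk⇔ (size≡⇒extremal G S dom) (extremal⇒size≡ G))
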